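{- Let $\mathbb{M}$ be a complete MV-chain, $Y$ a finite set and $f:\mathbb{M}^Y\to\mathbb{M}^Y$ a non-expansive function. Let $a\in\mathbb{M}^Y$ be a fixpoint of $f$. Then $\nu f_a^{\#}=\emptyset$ if and only if $a=\nu f$.
   Context: MV-algebras: an MV-algebra is a tuple $\mathbb{M}=(M,\oplus,0,\overline{(\cdot)})$ where $(M,\oplus,0)$ is a commutative monoid and $\overline{(\cdot)}:M\to M$ satisfies $\overline{\overline{x}}=x$, $x\oplus\overline{0}=\overline{0}$ and $\overline{(\overline{x}\oplus y)}\oplus y=\overline{(\overline{y}\oplus x)}\oplus x$ for all $x,y$. Put $1=\overline{0}$, $x\otimes y=\overline{\overline{x}\oplus\overline{y}}$, $x\ominus y=x\otimes\overline{y}$. The natural order is $x\sqsubseteq y$ iff $x\oplus z=y$ for some $z$; it is a lattice order with bottom $0$ and top $1$. $\mathbb{M}$ is an MV-chain if $\sqsubseteq$ is total, and complete if $(M,\sqsubseteq)$ is a complete lattice. Function spaces: $\mathbb{M}^Y$ is the set of functions $Y\to M$ with pointwise order and operations; $[b,c]=\{d\mid b\sqsubseteq d\sqsubseteq c\}$. For $Y'\subseteq Y$, $\delta\in\mathbb{M}$, $\delta_{Y'}$ is the function with value $\delta$ on $Y'$ and $0$ elsewhere; $\delta$ also denotes the constant function $\delta_Y$. The norm is $\|a\|=\max\{a(y)\mid y\in Y\}$. A function $f:\mathbb{M}^Y\to\mathbb{M}^Z$ ($Y,Z$ finite) is non-expansive if $\|f(b)\ominus f(a)\|\sqsubseteq\|b\ominus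 a\|$ for all $a,b\in\mathbb{M}^Y$; such $f$ is monotone. Fixpoints: $\nu g$ denotes the greatest fixpoint of a monotone function $g$ on a complete lattice (here $\mathbb{M}^Y$, or a powerset ordered by inclusion). Approximations: for $a\in\mathbb{M}^Y$ let $[Y]_a=\{y\in Y\mid a(y)\neq 1\}$ and $\delta_a=\min\{\overline{a(y)}\mid y\in[Y]_a\}$ with $\min\emptyset=1$. For $\delta\in\mathbb{M}$ let $\alpha_{a,\delta}:\mathbf{2}^{[Y]_a}\to[a,a\oplus\delta]$, $\alpha_{a,\delta}(Y')=a\oplus\delta_{Y'}$, and $\gamma_{a,\delta}:[a,a\oplus\delta]\to\mathbf{2}^{[Y]_a}$, $\gamma_{a,\delta}(b)=\{y\in[Y]_a\mid b(y)\ominus a(y)\sqsupseteq\delta\}$. For non-expansive $f:\mathbb{M}^Y\to\mathbb{M}^Z$ put $f_{a,\delta}^{\#}=\gamma_{f(a),\delta}\circ f\circ\alpha_{a,\delta}:\mathbf{2}^{[Y]_a}\to\mathbf{2}^{[Z]_{f(a)}}$. For $Y'\subseteq[Y]_a$, $z\in[Z]_{f(a)}$ let $\iota_a^f(Y',z)=\max\{\theta\in\mathbb{M}\mid z\in f_{a,\theta}^{\#}(Y')\}$ (the maximum exists when $\mathbb{M}$ is a complete MV-chain), and $\iota_a^f=\min\big(\{\iota_a^f(Y',z)\mid Y'\subseteq[Y]_a,\ z\in[Z]_{f(a)},\ \iota_a^f(Y',z)\neq 0\}\cup\{\delta_a\}\big)$. The $a$-approximation of $f$ is $f_a^{\#}=f_{a,\iota_a^f}^{\#}$.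 When $Z=Y$ and $f(a)=a$ it is a monotone endofunction of $\mathbf{2}^{[Y]_a}$. -}

module Defs where

open import Level using (Level; _⊔_; suc; Lift; lift; lower)
open import Algebra.Core using (Op₁; Op₂)
open import Algebra.Structures using (IsCommutativeMonoid)
open import Axiom.ExcludedMiddle using (ExcludedMiddle)
open import Data.Fin.Base using (Fin)
open import Data.Fin.Subset using (Subset; inside; outside; _∈_; _⊆_; ⊥)
open import Data.Fin.Subset.Properties using (_∈?_; _⊆?_; ⊆-min)
open import Data.List.Base as List using (List; filter; mapMaybe; cartesianProductWith; allFin)
import Data.List.Extrema
import Data.List.Relation.Unary.All as All
open import Data.List.Relation.Unary.All.Properties using (map⁻; map⁺; tabulate⁺)
open import Data.List.Membership.Propositional.Properties using (∈-allFin)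
open import Data.Maybe.Base using (Maybe; just; nothing)
open import Data.Nat.Base as ℕ using (ℕ)
open import Data.Product.Base using (_×_; _,_; ∃; proj₁; proj₂)
open import Data.Vec.Base using ([]; _∷_; tabulate)
open import Data.Vec.Properties using (lookup∘tabulate; lookup⇒[]=; []=⇒lookup)
open import Function.Base using (_∘_; flip)
open import Relation.Binary.Bundles using (TotalOrder)
open import Relation.Binary.Core using (Rel)
open import Relation.Binary.Definitions using (Total)
open import Relation.Binary.PropositionalEquality as ≡ using (_≡_)
import Relation.Binary.Reasoning.Setoid
open import Relation.Nullary.Decidable using (Dec; yes; no; does; map′; ¬?; _×-dec_; dec-true)
open import Relation.Nullary.Negation using (¬_)
open import Relation.Unary using (Pred; Decidable)

module _ {a r : Level} {A : Set a} (_≤_ : Rel A r) where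

  IsGreatest : ∀ {p} → Pred A p → Pred A (a ⊔ r ⊔ p)
  IsGreatest P m = P m × (∀ x → P x → x ≤ m)

  IsSupremum : ∀ {p} → Pred A p → Pred A (a ⊔ r ⊔ p)
  IsSupremum P s = (∀ x → P x → x ≤ s) × (∀ u → (∀ x → P x → x ≤ u) → s ≤ u)

  IsGreatestFixpoint : ∀ {e} → Rel A e → (A → A) → Pred A (a ⊔ r ⊔ e)
  IsGreatestFixpoint _≈_ g = IsGreatest (λ x → g x ≈ x)

record MVAlgebra c ℓ : Set (suc (c ⊔ ℓ)) where
  infix  8 ‾_
  infixl 7 _⊗_
  infixl 6 _⊕_ _⊖_
  infix  4 _≈_ _⊑_
  field
    Carrier             : Set c
    _≈_                 : Rel Carrier ℓ
    _⊕_                 : Op₂ Carrier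
    0#                  : Carrier
    ‾_                  : Op₁ Carrier
    isCommutativeMonoid : IsCommutativeMonoid _≈_ _⊕_ 0#
    ‾-cong              : ∀ {x y} → x ≈ y → ‾ x ≈ ‾ y
    ‾-involutive        : ∀ x → ‾ ‾ x ≈ x
    ⊕-zeroʳ             : ∀ x → x ⊕ ‾ 0# ≈ ‾ 0#
    łukasiewicz         : ∀ x y → ‾ (‾ x ⊕ y) ⊕ y ≈ ‾ (‾ y ⊕ x) ⊕ x

  open IsCommutativeMonoid isCommutativeMonoid public
    using (setoid; isEquivalence; refl; sym; trans; identityˡ; identityʳ; assoc; comm; ∙-cong)

  1# : Carrier
  1# = ‾ 0#

  _⊗_ _⊖_ : Op₂ Carrier
  x ⊗ y = ‾ (‾ x ⊕ ‾ y)
  x ⊖ y = x ⊗ ‾ y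

  _⊑_ : Rel Carrier (c ⊔ ℓ)
  x ⊑ y = ∃ λ z → x ⊕ z ≈ y

module MVAlgebraProperties {c ℓ : Level} (𝕄 : MVAlgebra c ℓ) where
  open MVAlgebra 𝕄
  open Relation.Binary.Reasoning.Setoid setoid

  ‾1≈0 : ‾ 1# ≈ 0#
  ‾1≈0 = ‾-involutive 0#

  ‾x⊕x≈1 : ∀ x → ‾ x ⊕ x ≈ 1#
  ‾x⊕x≈1 x = begin
    ‾ x ⊕ x                ≈⟨ ∙-cong (‾-cong (trans (∙-cong ‾1≈0 refl) (identityˡ x))) refl ⟨
    ‾ (‾ 1# ⊕ x) ⊕ x       ≈⟨ łukasiewicz 1# x ⟩
    ‾ (‾ x ⊕ 1#) ⊕ 1#      ≈⟨ ⊕-zeroʳ _ ⟩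
    1#                     ∎

  ⊑⇒‾⊕≈1 : ∀ {x y} → x ⊑ y → ‾ x ⊕ y ≈ 1#
  ⊑⇒‾⊕≈1 {x} {y} (z , x⊕z≈y) = begin
    ‾ x ⊕ y        ≈⟨ ∙-cong refl x⊕z≈y ⟨
    ‾ x ⊕ (x ⊕ z)  ≈⟨ assoc (‾ x) x z ⟨
    ‾ x ⊕ x ⊕ z    ≈⟨ ∙-cong (‾x⊕x≈1 x) refl ⟩
    1# ⊕ z         ≈⟨ comm 1# z ⟩
    z ⊕ 1#         ≈⟨ ⊕-zeroʳ z ⟩
    1#             ∎

  ‾⊕≈1⇒join : ∀ {x y} → ‾ x ⊕ y ≈ 1# → ‾ (‾ x ⊕ y) ⊕ y ≈ y
  ‾⊕≈1⇒join {x} {y} eq = trans (∙-cong (trans (‾-cong eq) ‾1≈0) refl) (identityˡ y)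

  ‾⊕≈1⇒⊑ : ∀ {x y} → ‾ x ⊕ y ≈ 1# → x ⊑ y
  ‾⊕≈1⇒⊑ {x} {y} eq = ‾ (‾ y ⊕ x) , (begin
    x ⊕ ‾ (‾ y ⊕ x)  ≈⟨ comm _ _ ⟩
    ‾ (‾ y ⊕ x) ⊕ x  ≈⟨ łukasiewicz y x ⟩
    ‾ (‾ x ⊕ y) ⊕ y  ≈⟨ ‾⊕≈1⇒join eq ⟩
    y                ∎)

  ⊑-reflexive : ∀ {x y} → x ≈ y → x ⊑ y
  ⊑-reflexive {x} x≈y = 0# , trans (identityʳ x) x≈y

  ⊑-refl : ∀ {x} → x ⊑ x
  ⊑-refl = ⊑-reflexive refl

  ⊑-trans : ∀ {x y z} → x ⊑ y → y ⊑ z → x ⊑ z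
  ⊑-trans {x} (u , x⊕u≈y) (v , y⊕v≈z) =
    u ⊕ v , trans (sym (assoc x u v)) (trans (∙-cong x⊕u≈y refl) y⊕v≈z)

  ⊑-antisym : ∀ {x y} → x ⊑ y → y ⊑ x → x ≈ y
  ⊑-antisym {x} {y} x⊑y y⊑x = begin
    x                ≈⟨ ‾⊕≈1⇒join (⊑⇒‾⊕≈1 y⊑x) ⟨
    ‾ (‾ y ⊕ x) ⊕ x  ≈⟨ łukasiewicz y x ⟩
    ‾ (‾ x ⊕ y) ⊕ y  ≈⟨ ‾⊕≈1⇒join (⊑⇒‾⊕≈1 x⊑y) ⟩
    y                ∎

  0⊑ : ∀ x → 0# ⊑ x
  0⊑ x = x , identityˡ x

  ⊕-monoˡ : ∀ z {x y} → x ⊑ y → x ⊕ z ⊑ y ⊕ z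
  ⊕-monoˡ z {x} {y} (u , x⊕u≈y) = u , (begin
    x ⊕ z ⊕ u    ≈⟨ assoc x z u ⟩
    x ⊕ (z ⊕ u)  ≈⟨ ∙-cong refl (comm z u) ⟩
    x ⊕ (u ⊕ z)  ≈⟨ assoc x u z ⟨
    x ⊕ u ⊕ z    ≈⟨ ∙-cong x⊕u≈y refl ⟩
    y ⊕ z        ∎)

  ⊕-monoʳ : ∀ z {x y} → x ⊑ y → z ⊕ x ⊑ z ⊕ y
  ⊕-monoʳ z {x} {y} x⊑y =
    ⊑-trans (⊑-reflexive (comm z x)) (⊑-trans (⊕-monoˡ z x⊑y) (⊑-reflexive (comm y z)))

  ‾-anti : ∀ {x y} → x ⊑ y → ‾ y ⊑ ‾ x
  ‾-anti {x} {y} x⊑y = ‾⊕≈1⇒⊑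
    (trans (∙-cong (‾-involutive y) refl) (trans (comm y (‾ x)) (⊑⇒‾⊕≈1 x⊑y)))

  ⊖-monoˡ : ∀ z {x y} → x ⊑ y → x ⊖ z ⊑ y ⊖ z
  ⊖-monoˡ z x⊑y = ‾-anti (⊕-monoˡ (‾ ‾ z) (‾-anti x⊑y))

  x⊖y≈‾[‾x⊕y] : ∀ x y → x ⊖ y ≈ ‾ (‾ x ⊕ y)
  x⊖y≈‾[‾x⊕y] x y = ‾-cong (∙-cong refl (‾-involutive y))

  ⊑⇒⊖⊑0 : ∀ {x y} → x ⊑ y → x ⊖ y ⊑ 0#
  ⊑⇒⊖⊑0 {x} {y} x⊑y =
    ⊑-reflexive (trans (x⊖y≈‾[‾x⊕y] x y) (trans (‾-cong (⊑⇒‾⊕≈1 x⊑y)) ‾1≈0))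

  ⊖⊑0⇒⊑ : ∀ {x y} → x ⊖ y ⊑ 0# → x ⊑ y
  ⊖⊑0⇒⊑ {x} {y} le = ‾⊕≈1⇒⊑ (begin
    ‾ x ⊕ y      ≈⟨ ‾-involutive _ ⟨
    ‾ ‾ (‾ x ⊕ y) ≈⟨ ‾-cong (x⊖y≈‾[‾x⊕y] x y) ⟨
    ‾ (x ⊖ y)    ≈⟨ ‾-cong (⊑-antisym le (0⊑ _)) ⟩
    1#           ∎)

record CompleteMVChain c ℓ : Set (suc (c ⊔ ℓ)) where
  field
    mvAlgebra : MVAlgebra c ℓ

  open MVAlgebra mvAlgebra public

  field
    ⊑-total    : Total _⊑_
    ⊑-complete : ∀ (P : Pred Carrier (c ⊔ ℓ)) →
                 ∃ (IsSupremum _⊑_ P) × ∃ (IsSupremum (flip _⊑_) P)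

  open MVAlgebraProperties mvAlgebra public

  totalOrder : TotalOrder c ℓ (c ⊔ ℓ)
  totalOrder = record
    { isTotalOrder = record
      { isPartialOrder = record
        { isPreorder = record
          { isEquivalence = isEquivalence
          ; reflexive     = ⊑-reflexive
          ; trans         = ⊑-trans
          }
        ; antisym = ⊑-antisym
        }
      ; total = ⊑-total
      }
    }

  ⋁ : Pred Carrier (c ⊔ ℓ) → Carrier
  ⋁ P = proj₁ (proj₁ (⊑-complete P))

-- Subsets of Fin n are Boolean vectors; 𝒫 A is the powerset of such a
-- subset A, ordered by inclusion of the underlying vectors.

｛_｝ : ∀ {n p} {P : Pred (Fin n) p} → Decidable P → Subset n
｛ P? ｝ = tabulate (does ∘ P?)

∈-｛｝⁻ : ∀ {n p} {P : Pred (Fin n) p} (P? : Decidable P) {y} → y ∈ ｛ P? ｝ → P y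
∈-｛｝⁻ P? {y} y∈ with P? y | ≡.trans (≡.sym (lookup∘tabulate (does ∘ P?) y)) ([]=⇒lookup y∈)
... | yes p | _ = p
... | no _  | ()

∈-｛｝⁺ : ∀ {n p} {P : Pred (Fin n) p} (P? : Decidable P) {y} → P y → y ∈ ｛ P? ｝
∈-｛｝⁺ P? {y} p =
  lookup⇒[]= y _ (≡.trans (lookup∘tabulate (does ∘ P?) y) (dec-true (P? y) p))

𝒫 : ∀ {n} → Subset n → Set
𝒫 A = ∃ λ S → S ⊆ A

module _ {n : ℕ} {A : Subset n} where

  infix 4 _≈ˢ_ _⊆ˢ_ _∈ˢ_

  _≈ˢ_ _⊆ˢ_ : Rel (𝒫 A) _
  S ≈ˢ S′ = proj₁ S ≡ proj₁ S′
  S ⊆ˢ S′ = proj₁ S ⊆ proj₁ S′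

  _∈ˢ_ : Fin n → 𝒫 A → Set
  y ∈ˢ S = y ∈ proj₁ S

  ∅ : 𝒫 A
  ∅ = ⊥ , ⊆-min A

allSubsets : ∀ n → List (Subset n)
allSubsets ℕ.zero    = [] List.∷ List.[]
allSubsets (ℕ.suc n) =
  cartesianProductWith _∷_ (outside List.∷ inside List.∷ List.[]) (allSubsets n)

powerset : ∀ {n} (A : Subset n) → List (𝒫 A)
powerset {n} A = mapMaybe restrict (allSubsets n)
  where
  restrict : Subset n → Maybe (𝒫 A)
  restrict S with S ⊆? A
  ... | yes S⊆A = just (S , S⊆A)
  ... | no _    = nothing

elements : ∀ {n} → Subset n → List (Fin n)
elements {n} A = filter (_∈? A) (allFin n)

-- The finite index sets Y, Z are Fin n, Fin m.  The mathematics is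
-- classical, so excluded middle (at the level of the order) is assumed; it is
-- what makes [Y]ₐ, γ and the non-zero ι-values available as finite sets.

module Approximation
  {c ℓ : Level} (em : ExcludedMiddle (c ⊔ ℓ)) (𝕄 : CompleteMVChain c ℓ) where

  open CompleteMVChain 𝕄
  open Data.List.Extrema totalOrder using (min; max; xs≤max; max≤v⁺)

  _≈?_ : ∀ x y → Dec (x ≈ y)
  x ≈? y = map′ lower lift (em {Lift c (x ≈ y)})

  _⊑?_ : ∀ x y → Dec (x ⊑ y)
  x ⊑? y = em

  infix 4 _≈ᶠ_ _⊑ᶠ_
  infixl 6 _⊕ᶠ_ _⊖ᶠ_

  𝕄^_ : ℕ → Set c
  𝕄^ n = Fin n → Carrier

  _≈ᶠ_ : ∀ {n} → Rel (𝕄^ n) ℓ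
  a ≈ᶠ b = ∀ y → a y ≈ b y

  _⊑ᶠ_ : ∀ {n} → Rel (𝕄^ n) (c ⊔ ℓ)
  a ⊑ᶠ b = ∀ y → a y ⊑ b y

  _⊕ᶠ_ _⊖ᶠ_ : ∀ {n} → Op₂ (𝕄^ n)
  (a ⊕ᶠ b) y = a y ⊕ b y
  (a ⊖ᶠ b) y = a y ⊖ b y

  step : ∀ {n} → Carrier → Subset n → 𝕄^ n
  step δ S y with y ∈? S
  ... | yes _ = δ
  ... | no _  = 0#

  -- The seed 0# is the least element; it only matters when n = 0.
  ‖_‖ : ∀ {n} → 𝕄^ n → Carrier
  ‖_‖ {n} a = max 0# (List.map a (allFin n))

  -- This forces f to respect _≈ᶠ_, so no separate congruence law is needed.
  NonExpansive : ∀ {n m} → (𝕄^ n → 𝕄^ m) → Set (c ⊔ ℓ)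
  NonExpansive f = ∀ a b → ‖ f b ⊖ᶠ f a ‖ ⊑ ‖ b ⊖ᶠ a ‖

  ≉1? : ∀ {n} (a : 𝕄^ n) → Decidable (λ y → ¬ (a y ≈ 1#))
  ≉1? a y = ¬? (a y ≈? 1#)

  [_] : ∀ {n} → 𝕄^ n → Subset n
  [ a ] = ｛ ≉1? a ｝

  δ[_] : ∀ {n} → 𝕄^ n → Carrier
  δ[ a ] = min 1# (List.map (λ y → ‾ a y) (elements [ a ]))

  -- α and γ are not restricted to the interval [a , a ⊕ δ]: the formulas make
  -- sense on all of 𝕄^ n, and the composite approxAt is the same.

  α : ∀ {n} (a : 𝕄^ n) → Carrier → 𝒫 [ a ] → 𝕄^ n
  α a δ (S , _) = a ⊕ᶠ step δ S

  γ : ∀ {n} (a : 𝕄^ n) → Carrier → 𝕄^ n → 𝒫 [ a ]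
  γ a δ b = ｛ P? ｝ , λ y∈ → proj₁ (∈-｛｝⁻ P? y∈)
    where P? = λ y → (y ∈? [ a ]) ×-dec (δ ⊑? (b y ⊖ a y))

  module _ {n m : ℕ} (f : 𝕄^ n → 𝕄^ m) (a : 𝕄^ n) where

    approxAt : Carrier → 𝒫 [ a ] → 𝒫 [ f a ]
    approxAt δ = γ (f a) δ ∘ f ∘ α a δ

    Admissible : 𝒫 [ a ] → Fin m → Pred Carrier (c ⊔ ℓ)
    Admissible S z θ = Lift (c ⊔ ℓ) (z ∈ˢ approxAt θ S)

    -- The maximum of the admissible θ, obtained as their supremum; that it is
    -- attained is proved in ι-isGreatest below.
    ι : 𝒫 [ a ] → Fin m → Carrier
    ι S z = ⋁ (Admissible S z)

    ι-min : Carrier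
    ι-min = min δ[ a ] (filter (λ θ → ¬? (θ ≈? 0#))
      (cartesianProductWith ι (powerset [ a ]) (elements [ f a ])))

    approx : 𝒫 [ a ] → 𝒫 [ f a ]
    approx = approxAt ι-min

  [-]-mono : ∀ {n} {a b : 𝕄^ n} → a ≈ᶠ b → [ a ] ⊆ [ b ]
  [-]-mono {a = a} {b} a≈b {y} y∈ =
    ∈-｛｝⁺ (≉1? b) λ by≈1 → ∈-｛｝⁻ (≉1? a) y∈ (trans (a≈b y) by≈1)

  -- At a fixpoint, [ f a ] and [ a ] have the same elements, so approx becomes
  -- an endofunction.
  approxEndo : ∀ {n} (f : 𝕄^ n → 𝕄^ n) (a : 𝕄^ n) → f a ≈ᶠ a → 𝒫 [ a ] → 𝒫 [ a ]
  approxEndo f a fa≈a S = proj₁ S′ , λ y∈ → [-]-mono fa≈a (proj₂ S′ y∈)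
    where S′ = approx f a S

  ≤‖‖ : ∀ {n} (a : 𝕄^ n) y → a y ⊑ ‖ a ‖
  ≤‖‖ {n} a y = All.lookup (map⁻ (xs≤max 0# (List.map a (allFin n)))) (∈-allFin y)

  ‖‖≤ : ∀ {n} (a : 𝕄^ n) {v} → (∀ y → a y ⊑ v) → ‖ a ‖ ⊑ v
  ‖‖≤ {n} a a≤v = max≤v⁺ (0⊑ _) (map⁺ {f = a} (tabulate⁺ {f = λ y → y} a≤v))

  nonExpansive⇒monotone : ∀ {n m} {f : 𝕄^ n → 𝕄^ m} → NonExpansive f →
                          ∀ {a b} → a ⊑ᶠ b → f a ⊑ᶠ f b
  nonExpansive⇒monotone {f = f} ne {a} {b} a⊑b z = ⊖⊑0⇒⊑
    (⊑-trans (≤‖‖ (f a ⊖ᶠ f b) z)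
      (⊑-trans (ne b a) (‖‖≤ (a ⊖ᶠ b) (λ y → ⊑⇒⊖⊑0 (a⊑b y)))))

  step-mono : ∀ {n} (S : Subset n) {δ δ′} → δ ⊑ δ′ → step δ S ⊑ᶠ step δ′ S
  step-mono S δ⊑δ′ y with y ∈? S
  ... | yes _ = δ⊑δ′
  ... | no _  = ⊑-refl

  ι-isGreatest : ∀ {n m} {f : 𝕄^ n → 𝕄^ m} → NonExpansive f → ∀ a S {z} → z ∈ [ f a ] →
                 IsGreatest _⊑_ (λ θ → z ∈ˢ approxAt f a θ S) (ι f a S z)
  ι-isGreatest {f = f} ne a S {z} z∈ =
    ∈-｛｝⁺ (P? s) (z∈ , least _ bound) , λ θ z∈θ → upper θ (lift z∈θ)
    where
    s     = ι f a S z
    P?    = λ θ y → (y ∈? [ f a ]) ×-dec (θ ⊑? (f (α a θ S) y ⊖ f a y))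
    upper = proj₁ (proj₂ (proj₁ (⊑-complete (Admissible f a S z))))
    least = proj₂ (proj₂ (proj₁ (⊑-complete (Admissible f a S z))))
    bound : ∀ θ → Admissible f a S z θ → θ ⊑ f (α a s S) z ⊖ f a z
    bound θ adm = ⊑-trans (proj₂ (∈-｛｝⁻ (P? θ) (lower adm)))
      (⊖-monoˡ (f a z) (nonExpansive⇒monotone ne
        (λ y → ⊕-monoʳ (a y) (step-mono (proj₁ S) (upper θ adm) y)) z))

{-# OPTIONS --safe #-}
-- Both directions use the greatest post-fixpoint (Knaster–Tarski).
--
-- Write δ for ι_a^f, which is non-zero.  If S ⊆ f_a^#(S), then a ⊕ δ_S is a
-- post-fixpoint of f, so a = νf gives a ⊕ δ_S ⊑ a; as δ ⊑ ‾ a(y) on [Y]_a, this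
-- forces S = ∅.
--
-- Conversely, let f(b) = b with d = ‖ b ⊖ a ‖ ≠ 0, let S be the set where
-- b ⊖ a equals d, and let ε < d bound b ⊖ a outside S.  Replacing b by
-- a ⊕ (d ⊖ ε)_S loses at most ε, so by non-expansiveness f still raises every
-- point of S by at least d ⊖ ε.  Hence ι_a^f(S, y) ≠ 0 for y ∈ S.  The same
-- estimate passes from ι_a^f(S, y) down to δ, so S ⊆ f_a^#(S), while S ≠ ∅.
module Submission where

open import Defs
open import Level using (Level; _⊔_; Lift; lift; lower; 0ℓ)
open import Axiom.ExcludedMiddle using (ExcludedMiddle)
open import Data.Fin.Base using (Fin)
open import Data.Fin.Subset using (Subset; _∈_; _⊆_; inside; outside)
open import Data.Fin.Subset.Properties using (_∈?_; _⊆?_; ⊆-antisym; ⊥⊆; ∉⊥)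
open import Data.List.Base as List using (filter; allFin; cartesianProductWith; mapMaybe)
import Data.List.Extrema
open import Data.List.Membership.Propositional using (lose) renaming (_∈_ to _∈ˡ_)
open import Data.List.Membership.Propositional.Properties
  using (∈-allFin; ∈-map⁺; ∈-filter⁺; ∈-cartesianProductWith⁺)
import Data.List.Relation.Unary.All as All
open import Data.List.Relation.Unary.All.Properties as All using (all-filter)
open import Data.List.Relation.Unary.Any as Any using (Any; here; there)
open import Data.List.Relation.Unary.Any.Properties as Any using (mapMaybe⁺)
open import Data.Maybe.Base using (Maybe)
import Data.Maybe.Relation.Unary.Any as Maybe
open import Data.Nat.Base using (ℕ)
open import Data.Product.Base using (_×_; _,_; ∃; proj₁; proj₂)
open import Data.Vec.Base using ([]; _∷_)
open import Function.Base using (_∘_; id; _∋_)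
open import Function.Bundles using (_⇔_; mk⇔)
open import Relation.Binary.Core using (Rel; _Preserves_⟶_)
open import Relation.Binary.Definitions using (Transitive; Antisym)
open import Relation.Binary.PropositionalEquality as ≡ using (_≡_)
open import Relation.Nullary.Decidable using (yes; no; map′; ¬?; _×-dec_)
open import Relation.Nullary.Negation using (¬_; contradiction)
open import Relation.Unary using (Pred; Decidable)

-- Greatest fixpoints and post-fixpoints.

module _ {a r e : Level} {A : Set a} {_≤_ : Rel A r} {_≈_ : Rel A e}
         (≤-trans : Transitive _≤_) (≤-antisym : Antisym _≤_ _≤_ _≈_)
         {g : A → A} (g-mono : g Preserves _≤_ ⟶ _≤_) where

  -- The supremum of the post-fixpoints is itself a fixpoint, hence below `m`.
  postfixpoint≤greatestFixpoint : ∃ (IsSupremum _≤_ (λ x → x ≤ g x)) →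
    ∀ {m} → IsGreatestFixpoint _≤_ _≈_ g m → ∀ {x} → x ≤ g x → x ≤ m
  postfixpoint≤greatestFixpoint (s , upper , least) (_ , greatest) {x} x≤gx =
    ≤-trans (upper x x≤gx) (greatest s (≤-antisym gs≤s s≤gs))
    where
    s≤gs : s ≤ g s
    s≤gs = least (g s) λ y y≤gy → ≤-trans y≤gy (g-mono (upper y y≤gy))
    gs≤s : g s ≤ s
    gs≤s = upper (g s) (g-mono s≤gs)

-- Enumeration of finite powersets.

∈-allSubsets : ∀ {n} (S : Subset n) → S ∈ˡ allSubsets n
∈-allSubsets []      = here ≡.refl
∈-allSubsets (x ∷ S) = ∈-cartesianProductWith⁺ _∷_ (∈-sides x) (∈-allSubsets S)
  where
  ∈-sides : ∀ x → x ∈ˡ outside List.∷ inside List.∷ List.[]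
  ∈-sides outside = here ≡.refl
  ∈-sides inside  = there (here ≡.refl)

mapMaybe-lose : ∀ {a b p} {A : Set a} {B : Set b} {P : Pred B p} (g : A → Maybe B) {x xs} →
                x ∈ˡ xs → Maybe.Any P (g x) → Any P (mapMaybe g xs)
mapMaybe-lose g x∈xs Pgx = mapMaybe⁺ g _ (Any.map⁺ (lose x∈xs Pgx))

-- powerset stores its own inclusion proofs, so P must hold for all of them.  The
-- list membership is abstracted together with S ⊆? A because the partial map
-- inside powerset cannot be named.
powerset⁺ : ∀ {n p} {A S : Subset n} {P : Pred (𝒫 A) p} →
            S ⊆ A → (∀ (S⊆A : S ⊆ A) → P (S , S⊆A)) → Any P (powerset A)
powerset⁺ {A = A} {S} {P} S⊆A PS
  with S ⊆? A | ((_ → Any P (powerset A)) ∋ mapMaybe-lose {P = P} _ (∈-allSubsets S))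
... | yes S⊆A′ | any = any (Maybe.just (PS S⊆A′))
... | no  S⊈A  | _   = contradiction (λ {x} → S⊆A {x}) S⊈A

∈-elements : ∀ {n} {A : Subset n} {y} → y ∈ A → y ∈ˡ elements A
∈-elements {A = A} {y} = ∈-filter⁺ (_∈? A) (∈-allFin y)

-- Residuation of truncated subtraction.

module MVAlgebraResiduation {c ℓ : Level} (𝕄 : MVAlgebra c ℓ) where
  open MVAlgebra 𝕄
  open MVAlgebraProperties 𝕄

  -- Since `x ⊑ y` amounts to `‾ x ⊕ y ≈ 1#`, this turns both sides of the adjunction between `⊖`
  -- and `⊕` into one equation.
  ‾[x⊖y]⊕z≈‾x⊕[y⊕z] : ∀ x y z → ‾ (x ⊖ y) ⊕ z ≈ ‾ x ⊕ (y ⊕ z)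
  ‾[x⊖y]⊕z≈‾x⊕[y⊕z] x y z = trans
    (∙-cong (trans (‾-cong (x⊖y≈‾[‾x⊕y] x y)) (‾-involutive _)) refl)
    (assoc (‾ x) y z)

  ⊖⊑⇒⊑⊕ : ∀ {x y z} → x ⊖ y ⊑ z → x ⊑ y ⊕ z
  ⊖⊑⇒⊑⊕ le = ‾⊕≈1⇒⊑ (trans (sym (‾[x⊖y]⊕z≈‾x⊕[y⊕z] _ _ _)) (⊑⇒‾⊕≈1 le))

  ⊑⊕⇒⊖⊑ : ∀ {x y z} → x ⊑ y ⊕ z → x ⊖ y ⊑ z
  ⊑⊕⇒⊖⊑ le = ‾⊕≈1⇒⊑ (trans (‾[x⊖y]⊕z≈‾x⊕[y⊕z] _ _ _) (⊑⇒‾⊕≈1 le))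

  ⊖-cong : ∀ {x x′ y y′} → x ≈ x′ → y ≈ y′ → x ⊖ y ≈ x′ ⊖ y′
  ⊖-cong x≈x′ y≈y′ = ‾-cong (∙-cong (‾-cong x≈x′) (‾-cong (‾-cong y≈y′)))

  ⊖-triangle : ∀ x y z → x ⊖ z ⊑ (x ⊖ y) ⊕ (y ⊖ z)
  ⊖-triangle x y z = ⊑⊕⇒⊖⊑ (⊑-trans (⊖⊑⇒⊑⊕ ⊑-refl)
    (⊑-trans (⊕-monoˡ (x ⊖ y) (⊖⊑⇒⊑⊕ ⊑-refl))
      (⊑-reflexive (trans (assoc z _ _) (∙-cong refl (comm _ _))))))

  x⊖y⊑x : ∀ x y → x ⊖ y ⊑ x
  x⊖y⊑x x y = ⊑⊕⇒⊖⊑ (y , comm x y)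

  x⊕[y⊖x]≈y : ∀ {x y} → x ⊑ y → x ⊕ (y ⊖ x) ≈ y
  x⊕[y⊖x]≈y {x} {y} x⊑y = trans (comm x _)
    (trans (∙-cong (x⊖y≈‾[‾x⊕y] y x) refl)
      (trans (łukasiewicz y x) (‾⊕≈1⇒join (⊑⇒‾⊕≈1 x⊑y))))

  x⊖[x⊖y]≈y : ∀ {x y} → y ⊑ x → x ⊖ (x ⊖ y) ≈ y
  x⊖[x⊖y]≈y {x} {y} y⊑x = trans (x⊖y≈‾[‾x⊕y] x (x ⊖ y))
    (trans (‾-cong (trans (∙-cong refl (‾-cong (trans (comm (‾ x) (‾ ‾ y))
      (∙-cong refl (sym (‾-involutive (‾ x)))))))
      (x⊕[y⊖x]≈y (‾-anti y⊑x)))) (‾-involutive y))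

  -- The bound `y ⊑ ‾ x` prevents truncation at `1#`: `‾ x ⊖ y` is `‾ (x ⊕ y)`, and subtracting it
  -- from `‾ x` gives both `y` and `0#`.
  x⊕y⊑x⇒y⊑0 : ∀ {x y} → y ⊑ ‾ x → x ⊕ y ⊑ x → y ⊑ 0#
  x⊕y⊑x⇒y⊑0 {x} {y} y⊑‾x x⊕y⊑x = ⊑-trans (⊑-reflexive (sym (x⊖[x⊖y]≈y y⊑‾x)))
    (⊑⇒⊖⊑0 (⊑-trans (‾-anti x⊕y⊑x)
      (⊑-reflexive (‾-cong (∙-cong (sym (‾-involutive x)) (sym (‾-involutive y)))))))

module Correctness {c ℓ : Level} (em : ExcludedMiddle (c ⊔ ℓ)) (𝕄 : CompleteMVChain c ℓ) where
  open CompleteMVChain 𝕄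
  open Approximation em 𝕄
  open MVAlgebraResiduation mvAlgebra
  open Data.List.Extrema totalOrder
    using (max; min≤⊤; min≤xs; xs≤max; max≤v⁺; argmin-all; argmax-all)

  -- Suprema, norms and step functions.

  ⋁ᶠ-exists : ∀ {n} (P : Pred (𝕄^ n) (c ⊔ ℓ)) → ∃ (IsSupremum _⊑ᶠ_ P)
  ⋁ᶠ-exists P = proj₁ ∘ sup , (λ b b∈P y → proj₁ (proj₂ (sup y)) (b y) (b , b∈P , ≡.refl)) ,
    λ u u-upper y → proj₂ (proj₂ (sup y)) (u y) λ { _ (b , b∈P , ≡.refl) → u-upper b b∈P y }
    where
    sup = λ y → proj₁ (⊑-complete (λ v → ∃ λ b → P b × b y ≡ v))

  ⋃-exists : ∀ {n} {A : Subset n} (P : Pred (𝒫 A) 0ℓ) → ∃ (IsSupremum (_⊆ˢ_ {A = A}) P)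
  ⋃-exists {n} {A} P = (｛ Q? ｝ , λ y∈ → let S , _ , y∈S = ∈-｛｝⁻ Q? y∈ in proj₂ S y∈S) ,
    (λ S S∈P y∈S → ∈-｛｝⁺ Q? (S , S∈P , y∈S)) ,
    λ U U-upper y∈ → let S , S∈P , y∈S = ∈-｛｝⁻ Q? y∈ in U-upper S S∈P y∈S
    where
    Q? : Decidable (λ y → ∃ λ (S : 𝒫 A) → P S × y ∈ˢ S)
    Q? y = map′ lower lift (em {Lift (c ⊔ ℓ) _})

  -- A maximum over a finite list is an entry or the seed, here `0#`. Serves to show that a norm is
  -- attained.
  ‖‖-all : ∀ {n p} {P : Pred Carrier p} {a : 𝕄^ n} → P 0# → (∀ y → P (a y)) → P ‖ a ‖
  ‖‖-all {P = P} P0 Pa = argmax-all id {P = P} P0 (All.map⁺ (All.tabulate⁺ Pa))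

  nonExpansive-pointwise : ∀ {n m} {f : 𝕄^ n → 𝕄^ m} → NonExpansive f → ∀ {a b v} →
    (∀ y → b y ⊑ a y ⊕ v) → ∀ z → f b z ⊑ f a z ⊕ v
  nonExpansive-pointwise {f = f} ne {a} {b} b⊑a⊕v z = ⊖⊑⇒⊑⊕
    (⊑-trans (≤‖‖ (f b ⊖ᶠ f a) z)
      (⊑-trans (ne a b) (‖‖≤ (b ⊖ᶠ a) (⊑⊕⇒⊖⊑ ∘ b⊑a⊕v))))

  step-∈ : ∀ {n} {S : Subset n} {δ y} → y ∈ S → step δ S y ≡ δ
  step-∈ {S = S} {y = y} y∈S with y ∈? S
  ... | yes _  = ≡.refl
  ... | no y∉S = contradiction y∈S y∉S

  step-⊆ : ∀ {n} {S T : Subset n} δ → S ⊆ T → step δ S ⊑ᶠ step δ T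
  step-⊆ {S = S} {T} δ S⊆T y with y ∈? S | y ∈? T
  ... | yes _   | yes _  = ⊑-refl
  ... | yes y∈S | no y∉T = contradiction (S⊆T y∈S) y∉T
  ... | no _    | _      = 0⊑ _

  step-split : ∀ {n} (S : Subset n) {δ θ} → θ ⊑ δ → ∀ y → step δ S y ⊑ step θ S y ⊕ (δ ⊖ θ)
  step-split S {δ} {θ} θ⊑δ y with y ∈? S
  ... | yes _ = ⊖⊑⇒⊑⊕ ⊑-refl
  ... | no _  = 0⊑ _

  module _ {n m : ℕ} (f : 𝕄^ n → 𝕄^ m) (a : 𝕄^ n) (θ : Carrier) (S : 𝒫 [ a ]) where
    -- A copy of the predicate local to `γ`, so that membership in `approxAt` unfolds to it by
    -- definition.
    gain? : Decidable (λ z → z ∈ [ f a ] × θ ⊑ f (α a θ S) z ⊖ f a z)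
    gain? z = (z ∈? [ f a ]) ×-dec (θ ⊑? (f (α a θ S) z ⊖ f a z))

    approxAt⁺ : ∀ {z} → z ∈ [ f a ] → θ ⊑ f (α a θ S) z ⊖ f a z → z ∈ˢ approxAt f a θ S
    approxAt⁺ z∈ le = ∈-｛｝⁺ gain? (z∈ , le)

    approxAt⁻ : ∀ {z} → z ∈ˢ approxAt f a θ S → θ ⊑ f (α a θ S) z ⊖ f a z
    approxAt⁻ = proj₂ ∘ ∈-｛｝⁻ gain?

  -- Bounds on `ι-min` and transfer of gains.

  module _ {n m : ℕ} (f : 𝕄^ n → 𝕄^ m) (a : 𝕄^ n) where

    nonzero-ι = filter (λ θ → ¬? (θ ≈? 0#))
      (cartesianProductWith (ι f a) (powerset [ a ]) (elements [ f a ]))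

    -- A finite minimum is an entry or the seed, and all of these are non-zero. The point `y`
    -- excludes the trivial algebra, in which `[ a ]` would be empty.
    ι-min≉0 : ∀ {y} → y ∈ [ a ] → ¬ (ι-min f a ≈ 0#)
    ι-min≉0 {y} y∈ = argmin-all id {P = λ θ → ¬ (θ ≈ 0#)}
      (argmin-all id {P = λ θ → ¬ (θ ≈ 0#)} 1≉0
        (All.map⁺ (All.map ‾a≉0 (all-filter (_∈? [ a ]) (allFin n)))))
      (all-filter (λ θ → ¬? (θ ≈? 0#))
        (cartesianProductWith (ι f a) (powerset [ a ]) (elements [ f a ])))
      where
      ‾a≉0 : ∀ {y} → y ∈ [ a ] → ¬ (‾ a y ≈ 0#)
      ‾a≉0 y∈ ‾ay≈0 = ∈-｛｝⁻ (≉1? a) y∈ (trans (sym (‾-involutive _)) (‾-cong ‾ay≈0))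
      1≉0 : ¬ (1# ≈ 0#)
      1≉0 1≈0 = ∈-｛｝⁻ (≉1? a) y∈
        (trans (sym (identityʳ _)) (trans (∙-cong refl (sym 1≈0)) (⊕-zeroʳ (a y))))

    ι-min⊑‾a : ∀ {y} → y ∈ [ a ] → ι-min f a ⊑ ‾ a y
    ι-min⊑‾a y∈ = ⊑-trans (min≤⊤ δ[ a ] nonzero-ι)
      (All.lookup (min≤xs 1# _) (∈-map⁺ (λ y → ‾ a y) (∈-elements y∈)))

    ι-min⊑ι : ∀ (S : 𝒫 [ a ]) {z} → z ∈ [ f a ] → ¬ (ι f a S z ≈ 0#) → ι-min f a ⊑ ι f a S z
    ι-min⊑ι S {z} z∈ ι≉0 = All.lookup (min≤xs δ[ a ] nonzero-ι)
      (∈-filter⁺ (λ θ → ¬? (θ ≈? 0#))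
      (Any.cartesianProductWith⁺ (ι f a) {P = λ T → ι f a S z ≡ ι f a T z}
        -- `ι` ignores the inclusion proof of a subset, so `≡.refl` covers whichever proof
        -- `powerset` stores.
        (λ { eq ≡.refl → eq }) (powerset⁺ (proj₂ S) (λ _ → ≡.refl)) (∈-elements z∈)) ι≉0)

    module _ (ne : NonExpansive f) (S : 𝒫 [ a ]) {z : Fin m} where

      -- Replacing `b` by `α a θ S` costs at most `d ⊖ θ` under `f`, which leaves `d ⊖ (d ⊖ θ)`,
      -- that is `θ`.
      gain-transfer : ∀ {b : 𝕄^ n} {d θ} → θ ⊑ d → (∀ y → b y ⊑ α a θ S y ⊕ (d ⊖ θ)) →
                      d ⊑ f b z ⊖ f a z → θ ⊑ f (α a θ S) z ⊖ f a z
      gain-transfer {b} {d} {θ} θ⊑d b⊑ d⊑gain =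
        ⊑-trans (⊑-reflexive (sym (x⊖[x⊖y]≈y θ⊑d)))
          (⊑⊕⇒⊖⊑ (⊑-trans d⊑gain (⊑-trans (⊖-triangle _ (f (α a θ S) z) _)
            (⊕-monoˡ _ (⊑⊕⇒⊖⊑ (nonExpansive-pointwise {f = f} ne b⊑ z))))))

      -- Two transfers: from `d` down to `θ`, which makes `θ` admissible and so `ι f a S z`
      -- non-zero; then from `ι f a S z` down to `ι-min f a`.
      approx⁺ : z ∈ [ f a ] → ∀ {b : 𝕄^ n} {d θ} → θ ⊑ d → ¬ (θ ≈ 0#) →
                (∀ y → b y ⊑ α a θ S y ⊕ (d ⊖ θ)) → d ⊑ f b z ⊖ f a z → z ∈ˢ approx f a S
      approx⁺ z∈ {θ = θ} θ⊑d θ≉0 b⊑ d⊑gain = approxAt⁺ f a (ι-min f a) S z∈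
        (gain-transfer β⊑ι
          (λ y → ⊑-trans (⊕-monoʳ (a y) (step-split (proj₁ S) β⊑ι y))
            (⊑-reflexive (sym (assoc (a y) _ _))))
          (approxAt⁻ f a (ι f a S z) S (proj₁ greatest)))
        where
        greatest = ι-isGreatest {f = f} ne a S z∈
        θ⊑ι : θ ⊑ ι f a S z
        θ⊑ι = proj₂ greatest θ (approxAt⁺ f a θ S z∈ (gain-transfer θ⊑d b⊑ d⊑gain))
        β⊑ι : ι-min f a ⊑ ι f a S z
        β⊑ι = ι-min⊑ι S z∈ λ ι≈0 →
          θ≉0 (⊑-antisym (⊑-trans θ⊑ι (⊑-reflexive ι≈0)) (0⊑ θ))

  -- The two implications at a fixpoint.

  module _ {n : ℕ} {f : 𝕄^ n → 𝕄^ n} (ne : NonExpansive f)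
           (a : 𝕄^ n) (fa≈a : f a ≈ᶠ a) where

    f# : 𝒫 [ a ] → 𝒫 [ a ]
    f# = approxEndo f a fa≈a

    f#-mono : f# Preserves _⊆ˢ_ ⟶ _⊆ˢ_
    f#-mono {S} {T} S⊆T {y} y∈ = approxAt⁺ f a (ι-min f a) T (proj₂ (approx f a S) y∈)
      (⊑-trans (approxAt⁻ f a (ι-min f a) S y∈)
        (⊖-monoˡ (f a y) (nonExpansive⇒monotone {f = f} ne
          (λ y → ⊕-monoʳ (a y) (step-⊆ {S = proj₁ S} (ι-min f a) S⊆T y)) y)))

    [a]⊆[fa] : [ a ] ⊆ [ f a ]
    [a]⊆[fa] = [-]-mono (sym ∘ fa≈a)

    postfixpoint-empty : IsGreatestFixpoint _⊑ᶠ_ _≈ᶠ_ f a → ∀ S → S ⊆ˢ f# S → S ⊆ˢ ∅ {A = [ a ]}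
    postfixpoint-empty gfp S S⊆f#S {y} y∈S =
      contradiction (⊑-antisym δ⊑0 (0⊑ δ)) (ι-min≉0 f a (proj₂ S y∈S))
      where
      δ = ι-min f a
      w = α a δ S
      mono = nonExpansive⇒monotone {f = f} ne
      a⊑fw : a ⊑ᶠ f w
      a⊑fw z = ⊑-trans (⊑-reflexive (sym (fa≈a z))) (mono (λ y → _ , refl) z)
      w⊑fw : w ⊑ᶠ f w
      w⊑fw z with z ∈? proj₁ S
      ... | no _    = ⊑-trans (⊑-reflexive (identityʳ (a z))) (a⊑fw z)
      -- `δ` is at most the gain `f w z ⊖ f a z`, and as `f a z ⊑ f w z`, adding `f a z` back gives
      -- exactly `f w z`.
      ... | yes z∈S = ⊑-trans (⊕-monoʳ (a z) (approxAt⁻ f a δ S (S⊆f#S z∈S)))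
        (⊑-reflexive (trans (∙-cong (sym (fa≈a z)) refl)
          (x⊕[y⊖x]≈y (⊑-trans (⊑-reflexive (fa≈a z)) (a⊑fw z)))))
      w⊑a : w ⊑ᶠ a
      w⊑a = postfixpoint≤greatestFixpoint (λ a⊑b b⊑c y → ⊑-trans (a⊑b y) (b⊑c y))
        (λ a⊑b b⊑a y → ⊑-antisym (a⊑b y) (b⊑a y)) mono (⋁ᶠ-exists _) gfp w⊑fw
      δ⊑0 : δ ⊑ 0#
      δ⊑0 = x⊕y⊑x⇒y⊑0 (ι-min⊑‾a f a (proj₂ S y∈S))
        (≡.subst (λ v → a y ⊕ v ⊑ a y) (step-∈ y∈S) (w⊑a y))

    gfp⇒f#-gfp : IsGreatestFixpoint _⊑ᶠ_ _≈ᶠ_ f a → IsGreatestFixpoint _⊆ˢ_ _≈ˢ_ f# ∅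
    gfp⇒f#-gfp gfp =
      -- From `∅ ⊆ f# ∅`, monotonicity makes `f# ∅` a post-fixpoint, hence empty.
      ⊆-antisym (postfixpoint-empty gfp (f# ∅) (f#-mono {∅} {f# ∅} ⊥⊆)) ⊥⊆ ,
      λ S f#S≈S → postfixpoint-empty gfp S (λ {y} → ≡.subst (y ∈_) (≡.sym f#S≈S))

    f#-gfp⇒gfp : IsGreatestFixpoint _⊆ˢ_ _≈ˢ_ f# ∅ → IsGreatestFixpoint _⊑ᶠ_ _≈ᶠ_ f a
    f#-gfp⇒gfp f#-gfp = fa≈a , below
      where
      below : ∀ b → f b ≈ᶠ b → b ⊑ᶠ a
      below b fb≈b with ‖ b ⊖ᶠ a ‖ ≈? 0#
      ... | yes d≈0 = λ y → ⊖⊑0⇒⊑ (⊑-trans (≤‖‖ (b ⊖ᶠ a) y) (⊑-reflexive d≈0))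
      ... | no  d≉0 =
        -- If no value of `g` equalled `d`, the maximum `d` would differ from itself.
        contradiction refl (‖‖-all {P = λ v → ¬ (v ≈ d)} {a = g} (d≉0 ∘ sym) g≉d)
        where
        g = b ⊖ᶠ a
        d = ‖ g ‖
        maximal? = λ y → g y ≈? d
        S : 𝒫 [ a ]
        -- Where `a y ≈ 1#` the difference `g y` vanishes, while `d` does not.
        S = ｛ maximal? ｝ , λ {y} y∈ → ∈-｛｝⁺ (≉1? a) λ ay≈1 → d≉0
          (trans (sym (∈-｛｝⁻ maximal? y∈))
            (⊑-antisym (⊑⇒⊖⊑0 (1# , trans (⊕-zeroʳ (b y)) (sym ay≈1))) (0⊑ _)))
        submaximal = filter (λ v → ¬? (v ≈? d)) (List.map g (allFin n))
        -- The largest value of `g` other than `d`, or `0#` if there is none; `d≉0` keeps this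
        -- default strictly below `d`.
        ε = max 0# submaximal
        ε⊑d : ε ⊑ d
        ε⊑d = max≤v⁺ (0⊑ d)
          (All.filter⁺ (λ v → ¬? (v ≈? d)) (All.map⁺ {f = g} (All.tabulate⁺ {f = id} (≤‖‖ g))))
        ε≉d : ¬ (ε ≈ d)
        ε≉d = argmax-all id {P = λ v → ¬ (v ≈ d)} (d≉0 ∘ sym)
          (all-filter (λ v → ¬? (v ≈? d)) (List.map g (allFin n)))
        g⊑ε : ∀ {y} → ¬ (g y ≈ d) → g y ⊑ ε
        g⊑ε {y} gy≉d = All.lookup (xs≤max 0# submaximal)
          (∈-filter⁺ (λ v → ¬? (v ≈? d)) (∈-map⁺ g (∈-allFin y)) gy≉d)
        θ = d ⊖ ε
        g⊑ : ∀ y → g y ⊑ step θ (proj₁ S) y ⊕ ε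
        g⊑ y with y ∈? proj₁ S
        ... | yes _  = ⊑-trans (≤‖‖ g y) (⊑-trans (⊖⊑⇒⊑⊕ ⊑-refl) (⊑-reflexive (comm ε θ)))
        ... | no y∉S = ⊑-trans (g⊑ε (y∉S ∘ ∈-｛｝⁺ maximal?)) (⊑-reflexive (sym (identityˡ ε)))
        b⊑ : ∀ y → b y ⊑ α a θ S y ⊕ (d ⊖ θ)
        b⊑ y = ⊑-trans (⊖⊑⇒⊑⊕ (g⊑ y)) (⊑-reflexive
          (trans (sym (assoc (a y) _ ε)) (∙-cong refl (sym (x⊖[x⊖y]≈y ε⊑d)))))
        θ≉0 : ¬ (θ ≈ 0#)
        θ≉0 θ≈0 = ε≉d (⊑-antisym ε⊑d (⊖⊑0⇒⊑ (⊑-reflexive θ≈0)))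
        S⊆f#S : S ⊆ˢ f# S
        -- As `b` and `a` are fixpoints, the gain `f b y ⊖ f a y` is `g y`, which is `d` on `S`.
        S⊆f#S {y} y∈ = approx⁺ f a ne S ([a]⊆[fa] (proj₂ S y∈)) {b = b} (x⊖y⊑x d ε) θ≉0 b⊑
          (⊑-reflexive (trans (sym (∈-｛｝⁻ maximal? y∈))
            (sym (⊖-cong (fb≈b y) (fa≈a y)))))
        g≉d : ∀ y → ¬ (g y ≈ d)
        g≉d y gy≈d = ∉⊥ (S⊆∅ (∈-｛｝⁺ maximal? gy≈d))
          where
          S⊆∅ : S ⊆ˢ ∅ {A = [ a ]}
          S⊆∅ = postfixpoint≤greatestFixpoint {_≤_ = _⊆ˢ_ {A = [ a ]}} {_≈_ = _≈ˢ_}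
            (λ S⊆T T⊆U y∈ → T⊆U (S⊆T y∈)) ⊆-antisym {f#} (λ {S} {T} → f#-mono {S} {T})
            (⋃-exists (λ T → T ⊆ˢ f# T)) {∅} f#-gfp {S} S⊆f#S

theorem4p2 : ∀ {c ℓ} (em : ExcludedMiddle (c ⊔ ℓ)) (𝕄 : CompleteMVChain c ℓ) →
    let open CompleteMVChain 𝕄
        open Approximation em 𝕄 in
    (n : ℕ) (f : 𝕄^ n → 𝕄^ n) → NonExpansive f →
    (a : 𝕄^ n) (fa≈a : f a ≈ᶠ a) →
    IsGreatestFixpoint _⊆ˢ_ _≈ˢ_ (approxEndo f a fa≈a) ∅
      ⇔ IsGreatestFixpoint _⊑ᶠ_ _≈ᶠ_ f a
theorem4p2 em 𝕄 n f ne a fa≈a = mk⇔ (f#-gfp⇒gfp ne a fa≈a) (gfp⇒f#-gfp ne a fa≈a)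
  where open Correctness em 𝕄
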